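{- Let $D$ be a biorientation of a complete split graph. If $D$ has a sink, then there is a unique minimum-size quasi-kernel of $D$, and it is the set of all sinks of $D$. If $D$ is sink-free, then the minimal size of a quasi-kernel of $D$ is at most two.
   Context: All graphs and digraphs are finite and loopless. A complete split graph is an undirected graph whose vertex set can be partitioned into a clique (the clique-part) and an independent set (the independent-part) such that every vertex of the independent-part is adjacent to every vertex of the clique-part. A biorientation of an undirected graph is a digraph obtained by replacing each edge $uv$ by the single arc $(u,v)$, or the single arc $(v,u)$, or both arcs $(u,v)$ and $(v,u)$. A sink is a vertex with no outneighbor; a digraph is sink-free if it has no sink. A quasi-kernel of a digraph $D$ is an independent set $Q\subseteq V(D)$ (no arc between any two vertices of $Q$) such that from every vertex of $D$ there is a directed path of length at most two to some vertex of $Q$ (length zero for vertices of $Q$). -}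

module Defs where

open import Level using (0ℓ)
open import Data.Nat using (ℕ; suc; _≤_)
open import Data.Fin using (Fin; zero; suc; inject₁; fromℕ)
open import Data.Fin.Subset using (Subset; _∈_; ∁; ∣_∣)
open import Data.Product using (_×_; ∃-syntax)
open import Data.Sum using (_⊎_)
open import Function.Definitions using (Injective)
open import Relation.Binary using (Rel; Decidable; Symmetric)
open import Relation.Binary.PropositionalEquality using (_≡_; _≢_)
open import Relation.Nullary using (¬_)

record Graph (n : ℕ) : Set₁ where
  field
    Adj       : Rel (Fin n) 0ℓ
    adj?      : Decidable Adj
    symmetric : Symmetric Adj
    loopless  : ∀ v → ¬ Adj v v

record Digraph (n : ℕ) : Set₁ where
  field
    Arc      : Rel (Fin n) 0ℓ
    arc?     : Decidable Arc
    loopless : ∀ v → ¬ Arc v v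

-- The independent-part is the complement of the clique-part; either part
-- may be empty.
record IsCompleteSplit {n : ℕ} (G : Graph n) : Set where
  open Graph G
  field
    cliquePart : Subset n

  independentPart : Subset n
  independentPart = ∁ cliquePart

  field
    clique      : ∀ u v → u ∈ cliquePart → v ∈ cliquePart → u ≢ v → Adj u v
    independent : ∀ u v → u ∈ independentPart → v ∈ independentPart → ¬ Adj u v
    complete    : ∀ u v → u ∈ independentPart → v ∈ cliquePart → Adj u v

-- ⊎ is inclusive: an edge may yield both arcs.
record IsBiorientation {n : ℕ} (G : Graph n) (D : Digraph n) : Set where
  open Graph G using (Adj)
  open Digraph D using (Arc)
  field
    edge⇒arc : ∀ u v → Adj u v → Arc u v ⊎ Arc v u
    arc⇒edge : ∀ u v → Arc u v → Adj u v

module _ {n : ℕ} (D : Digraph n) where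
  open Digraph D

  IsSink : Fin n → Set
  IsSink v = ∀ w → ¬ Arc v w

  HasSink : Set
  HasSink = ∃[ v ] IsSink v

  SinkFree : Set
  SinkFree = ¬ HasSink

  record DirectedPath (u v : Fin n) (ℓ : ℕ) : Set where
    field
      vertex   : Fin (suc ℓ) → Fin n
      start    : vertex zero ≡ u
      end      : vertex (fromℕ ℓ) ≡ v
      step     : ∀ (i : Fin ℓ) → Arc (vertex (inject₁ i)) (vertex (suc i))
      distinct : Injective _≡_ _≡_ vertex

  IsIndependent : Subset n → Set
  IsIndependent Q = ∀ u v → u ∈ Q → v ∈ Q → ¬ Arc u v

  record IsQuasiKernel (Q : Subset n) : Set where
    field
      independent : IsIndependent Q
      absorbing   : ∀ v → ∃[ q ] (q ∈ Q × ∃[ ℓ ] (ℓ ≤ 2 × DirectedPath v q ℓ))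

  record IsMinimumQuasiKernel (Q : Subset n) : Set where
    field
      isQuasiKernel : IsQuasiKernel Q
      minimum       : ∀ Q′ → IsQuasiKernel Q′ → ∣ Q ∣ ≤ ∣ Q′ ∣

{-# OPTIONS --safe #-}

-- If D has a sink s, the sinks are independent, and a non-sink has an arc to s
-- or to a clique vertex, which has an arc to s.  Since every quasi-kernel
-- contains all sinks, the set of sinks is the only one of minimum size.
--
-- Let D be sink-free.  If the independent-part is empty, a king (a vertex
-- reached from all others in at most two steps) is a quasi-kernel.  Otherwise
-- let v be a vertex of the independent-part of maximum in-degree and B the set
-- of clique vertices with no arc to v.  If B is empty, {v} is a quasi-kernel.
-- If not, let b be a king of B.  Then b is reached from v and from the whole
-- clique, so if {b} is not a quasi-kernel, some x in the independent-part does
-- not reach b; hence b and all its in-neighbours in the clique have arcs to x,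
-- and the clique reaches {v, x}.  A vertex u of the independent-part reaching
-- neither v nor x would have N⁻(v) ∪ {b} ⊆ N⁻(u), against the choice of v.
module Submission where

open import Data.Nat using (ℕ; zero; suc; _+_; _≤_; _<_; _<?_; z≤n; s≤s)
open import Data.Nat.Induction using (<-wellFounded)
open import Data.Nat.Properties
  using (≤-refl; ≤-reflexive; ≤-trans; ≮⇒≥; <⇒≱; +-mono-≤; +-monoʳ-≤; +-suc; m≤n⇒m≤1+n)
open import Data.Fin using (Fin; zero; suc)
open import Data.Fin.Properties using (_≟_; any?; all?)
open import Data.Fin.Subset
  using (Subset; inside; outside; _∈_; _∉_; _⊆_; _∪_; ⁅_⁆; ⊥; ∣_∣)
open import Data.Fin.Subset.Properties
  using (_∈?_; anySubset?; x∈⁅x⁆; x∈⁅y⁆⇒x≡y; x∈p∪q⁺; x∈p∪q⁻; ∣⁅x⁆∣≡1; ∣⊥∣≡0; ∉⊥;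
         p⊆q⇒∣p∣≤∣q∣; p⊂q⇒∣p∣<∣q∣; ⊆-antisym; x∉p⇒x∈∁p)
open import Data.List using (List; []; _∷_; filter; allFin)
open import Data.List.Extrema.Nat using (argmax; argmax-all; f[xs]≤f[argmax])
open import Data.List.Membership.Propositional using () renaming (_∈_ to _∈ₗ_)
open import Data.List.Membership.Propositional.Properties
  using (∈-filter⁺; ∈-filter⁻; ∈-allFin)
open import Data.List.Relation.Unary.All using (lookup)
open import Data.List.Relation.Unary.All.Properties using (all-filter)
open import Data.List.Relation.Unary.Any using (here; there)
open import Data.Product using (_×_; _,_; proj₁; proj₂; ∃; ∃!; ∃-syntax)
open import Data.Sum using (_⊎_; inj₁; inj₂; map₂; swap)
open import Data.Vec using ([]; _∷_; tabulate)
open import Data.Vec.Properties using (lookup∘tabulate; lookup⇒[]=; []=⇒lookup)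
open import Function using (_∘_)
open import Function.Bundles using (_⇔_; mk⇔)
open import Induction.WellFounded using (Acc; acc)
open import Relation.Binary.PropositionalEquality
  using (_≡_; _≢_; refl; sym; trans; subst; subst₂)
open import Relation.Nullary using (¬_; Dec; yes; no; does; contradiction)
open import Relation.Nullary.Decidable
  using (dec-true; map′; ¬?; _×-dec_; _⊎-dec_; _→-dec_; decidable-stable)
open import Relation.Unary using (Pred; Decidable)
open import Level using (0ℓ)
open import Defs

-- Extremal vertices and subsets of a finite set

comprehension : ∀ {n} {P : Pred (Fin n) 0ℓ} → Decidable P → Subset n
comprehension P? = tabulate (does ∘ P?)

module _ {n : ℕ} {P : Pred (Fin n) 0ℓ} (P? : Decidable P) where

  ∈-comprehension⁺ : ∀ {x} → P x → x ∈ comprehension P?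
  ∈-comprehension⁺ {x} px =
    lookup⇒[]= x _ (trans (lookup∘tabulate (does ∘ P?) x) (dec-true (P? x) px))

  ∈-comprehension⁻ : ∀ {x} → x ∈ comprehension P? → P x
  ∈-comprehension⁻ {x} x∈
    with P? x | trans (sym (lookup∘tabulate (does ∘ P?) x)) ([]=⇒lookup x∈)
  ... | yes px | _ = px
  ... | no _   | ()

  maximiser : (f : Fin n → ℕ) → ∃ P → ∃[ v ] (P v × (∀ u → P u → f u ≤ f v))
  maximiser f (v₀ , pv₀) =
    -- `argmax` may return its default `v₀`; since `v₀` satisfies `P` as well, so does the result.
    argmax f v₀ candidates ,
    argmax-all f pv₀ (all-filter P? (allFin n)) ,
    λ u pu → lookup (f[xs]≤f[argmax] v₀ candidates) (∈-filter⁺ P? (∈-allFin u) pu)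
    where
    candidates : List (Fin n)
    candidates = filter P? (allFin n)

-- Descent on the size: as long as the search over all subsets finds a smaller one with `P`, pass to
-- that one.
minimumSubset : ∀ {n} {P : Pred (Subset n) 0ℓ} → Decidable P → ∃ P →
  ∃[ Q ] (P Q × (∀ Q′ → P Q′ → ∣ Q ∣ ≤ ∣ Q′ ∣))
minimumSubset {P = P} P? (Q₀ , pQ₀) = go Q₀ pQ₀ (<-wellFounded ∣ Q₀ ∣)
  where
  go : ∀ Q → P Q → Acc _<_ ∣ Q ∣ → ∃[ Q ] (P Q × (∀ Q′ → P Q′ → ∣ Q ∣ ≤ ∣ Q′ ∣))
  go Q pQ (acc rec) with anySubset? (λ Q′ → P? Q′ ×-dec ∣ Q′ ∣ <? ∣ Q ∣)
  ... | yes (Q′ , pQ′ , lt) = go Q′ pQ′ (rec lt)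
  ... | no none = Q , pQ , λ Q′ pQ′ → ≮⇒≥ λ lt → none (Q′ , pQ′ , lt)

∣p∪q∣≤∣p∣+∣q∣ : ∀ {n} (p q : Subset n) → ∣ p ∪ q ∣ ≤ ∣ p ∣ + ∣ q ∣
∣p∪q∣≤∣p∣+∣q∣ []            []            = z≤n
∣p∪q∣≤∣p∣+∣q∣ (outside ∷ p) (outside ∷ q) = ∣p∪q∣≤∣p∣+∣q∣ p q
∣p∪q∣≤∣p∣+∣q∣ (outside ∷ p) (inside ∷ q)  =
  ≤-trans (s≤s (∣p∪q∣≤∣p∣+∣q∣ p q)) (≤-reflexive (sym (+-suc ∣ p ∣ ∣ q ∣)))
∣p∪q∣≤∣p∣+∣q∣ (inside ∷ p)  (outside ∷ q) = s≤s (∣p∪q∣≤∣p∣+∣q∣ p q)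
∣p∪q∣≤∣p∣+∣q∣ (inside ∷ p)  (inside ∷ q)  =
  s≤s (≤-trans (∣p∪q∣≤∣p∣+∣q∣ p q) (+-monoʳ-≤ ∣ p ∣ (m≤n⇒m≤1+n ≤-refl)))

p⊆q∧∣q∣≤∣p∣⇒p≡q : ∀ {n} {p q : Subset n} → p ⊆ q → ∣ q ∣ ≤ ∣ p ∣ → p ≡ q
p⊆q∧∣q∣≤∣p∣⇒p≡q {p = p} {q} p⊆q ∣q∣≤∣p∣ = ⊆-antisym p⊆q q⊆p
  where
  q⊆p : q ⊆ p
  q⊆p {x} x∈q = decidable-stable (x ∈? p) λ x∉p →
    <⇒≱ (p⊂q⇒∣p∣<∣q∣ (p⊆q , x , x∈q , x∉p)) ∣q∣≤∣p∣

-- Walks of length at most two, and quasi-kernels in terms of them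

module _ {n : ℕ} (D : Digraph n) where
  open Digraph D

  -- Walks instead of paths: `w` is arbitrary and `v` may equal `q` in the last case. This makes
  -- reachability decidable by search and spares later arguments all distinctness checks.
  Reaches : Fin n → Fin n → Set
  Reaches v q = v ≡ q ⊎ Arc v q ⊎ ∃[ w ] (Arc v w × Arc w q)

  reaches? : ∀ v q → Dec (Reaches v q)
  reaches? v q = v ≟ q ⊎-dec arc? v q ⊎-dec any? (λ w → arc? v w ×-dec arc? w q)

  path⇒reaches : ∀ {v q ℓ} → ℓ ≤ 2 → DirectedPath D v q ℓ → Reaches v q
  path⇒reaches {ℓ = 0} _ p = inj₁ (trans (sym start) end)
    where open DirectedPath p
  path⇒reaches {ℓ = 1} _ p = inj₂ (inj₁ (subst₂ Arc start end (step zero)))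
    where open DirectedPath p
  path⇒reaches {ℓ = 2} _ p = inj₂ (inj₂
    (vertex (suc zero) ,
     subst (λ v → Arc v _) start (step zero) ,
     subst (Arc _) end (step (suc zero))))
    where open DirectedPath p
  path⇒reaches {ℓ = suc (suc (suc _))} (s≤s (s≤s ())) _

  arc⇒≢ : ∀ {v w} → Arc v w → v ≢ w
  arc⇒≢ v→w refl = loopless _ v→w

  path₀ : ∀ v → DirectedPath D v v 0
  path₀ v = record
    { vertex = λ _ → v ; start = refl ; end = refl ; step = λ ()
    ; distinct = λ { {zero} {zero} _ → refl } }

  path₁ : ∀ {v q} → Arc v q → DirectedPath D v q 1
  path₁ {v} {q} v→q = record
    { vertex = λ { zero → v ; (suc _) → q } ; start = refl ; end = refl
    ; step = λ { zero → v→q }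
    ; distinct = λ
        { {zero} {zero} _ → refl
        ; {zero} {suc zero} eq → contradiction eq (arc⇒≢ v→q)
        ; {suc zero} {zero} eq → contradiction (sym eq) (arc⇒≢ v→q)
        ; {suc zero} {suc zero} _ → refl } }

  path₂ : ∀ {v w q} → v ≢ q → Arc v w → Arc w q → DirectedPath D v q 2
  path₂ {v} {w} {q} v≢q v→w w→q = record
    { vertex = λ { zero → v ; (suc zero) → w ; (suc (suc _)) → q }
    ; start = refl ; end = refl
    ; step = λ { zero → v→w ; (suc zero) → w→q }
    ; distinct = λ
        { {zero} {zero} _ → refl
        ; {zero} {suc zero} eq → contradiction eq (arc⇒≢ v→w)
        ; {zero} {suc (suc zero)} eq → contradiction eq v≢q
        ; {suc zero} {zero} eq → contradiction (sym eq) (arc⇒≢ v→w)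
        ; {suc zero} {suc zero} _ → refl
        ; {suc zero} {suc (suc zero)} eq → contradiction eq (arc⇒≢ w→q)
        ; {suc (suc zero)} {zero} eq → contradiction (sym eq) v≢q
        ; {suc (suc zero)} {suc zero} eq → contradiction (sym eq) (arc⇒≢ w→q)
        ; {suc (suc zero)} {suc (suc zero)} _ → refl } }

  reaches⇒path : ∀ {v q} → Reaches v q → ∃[ ℓ ] (ℓ ≤ 2 × DirectedPath D v q ℓ)
  reaches⇒path (inj₁ refl) = 0 , z≤n , path₀ _
  reaches⇒path (inj₂ (inj₁ v→q)) = 1 , s≤s z≤n , path₁ v→q
  reaches⇒path {v} {q} (inj₂ (inj₂ (w , v→w , w→q))) with v ≟ q
  -- A closed walk of length two is not a path, but then the path of length zero serves.
  ... | yes refl = 0 , z≤n , path₀ _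
  ... | no v≢q   = 2 , ≤-refl , path₂ v≢q v→w w→q

  Absorbing : Subset n → Set
  Absorbing Q = ∀ v → ∃[ q ] (q ∈ Q × Reaches v q)

  quasiKernel⁺ : ∀ {Q} → IsIndependent D Q → Absorbing Q → IsQuasiKernel D Q
  quasiKernel⁺ ind abs = record
    { independent = ind
    ; absorbing = λ v → let q , q∈Q , r = abs v in q , q∈Q , reaches⇒path r }

  quasiKernel⇒absorbing : ∀ {Q} → IsQuasiKernel D Q → Absorbing Q
  quasiKernel⇒absorbing qk v =
    let q , q∈Q , ℓ , ℓ≤2 , p = IsQuasiKernel.absorbing qk v
    in q , q∈Q , path⇒reaches ℓ≤2 p

  isQuasiKernel? : Decidable (IsQuasiKernel D)
  isQuasiKernel? Q = map′
    (λ (ind , abs) → quasiKernel⁺ ind abs)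
    (λ qk → IsQuasiKernel.independent qk , quasiKernel⇒absorbing qk)
    (all? (λ u → all? λ v → (u ∈? Q) →-dec (v ∈? Q) →-dec ¬? (arc? u v))
     ×-dec all? (λ v → any? λ q → (q ∈? Q) ×-dec reaches? v q))

  -- Sinks and their place in quasi-kernels

  isSink? : Decidable (IsSink D)
  isSink? v = all? λ w → ¬? (arc? v w)

  outNeighbour : ∀ {v} → ¬ IsSink D v → ∃ (Arc v)
  outNeighbour {v} ¬sink with any? (arc? v)
  ... | yes out = out
  ... | no none = contradiction (λ w v→w → none (w , v→w)) ¬sink

  sinks : Subset n
  sinks = comprehension isSink?

  -- The only walk that starts at a sink has length zero.
  sink∈quasiKernel : ∀ {Q v} → IsQuasiKernel D Q → IsSink D v → v ∈ Q
  sink∈quasiKernel {v = v} qk sink with quasiKernel⇒absorbing qk v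
  ... | q , q∈Q , inj₁ refl = q∈Q
  ... | q , _ , inj₂ (inj₁ v→q) = contradiction v→q (sink q)
  ... | q , _ , inj₂ (inj₂ (w , v→w , _)) = contradiction v→w (sink w)

  -- Every quasi-kernel includes `sinks`, so `sinks` has minimum size, and a quasi-kernel that is no
  -- larger must coincide with it.
  sinks-uniqueMinimum : IsQuasiKernel D sinks →
    ∃! _≡_ (IsMinimumQuasiKernel D) ×
    (∀ Q → IsMinimumQuasiKernel D Q → ∀ v → (v ∈ Q ⇔ IsSink D v))
  sinks-uniqueMinimum qk =
    (sinks ,
     record { isQuasiKernel = qk ; minimum = λ Q → p⊆q⇒∣p∣≤∣q∣ ∘ sinks⊆ } ,
     unique) ,
    λ Q min v → mk⇔
      (λ v∈Q → ∈-comprehension⁻ isSink? (subst (v ∈_) (sym (unique min)) v∈Q))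
      (sink∈quasiKernel (IsMinimumQuasiKernel.isQuasiKernel min))
    where
    sinks⊆ : ∀ {Q} → IsQuasiKernel D Q → sinks ⊆ Q
    sinks⊆ qk′ x∈ = sink∈quasiKernel qk′ (∈-comprehension⁻ isSink? x∈)

    unique : ∀ {Q} → IsMinimumQuasiKernel D Q → sinks ≡ Q
    unique min = p⊆q∧∣q∣≤∣p∣⇒p≡q (sinks⊆ isQuasiKernel) (minimum sinks qk)
      where open IsMinimumQuasiKernel min

  -- Quasi-kernels of at most two vertices

  small⇒minimum : ∀ {k} → ∃[ Q ] (IsQuasiKernel D Q × ∣ Q ∣ ≤ k) →
    ∃[ Q ] (IsMinimumQuasiKernel D Q × ∣ Q ∣ ≤ k)
  small⇒minimum (Q₀ , qk₀ , ∣Q₀∣≤k) =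
    -- A minimum quasi-kernel exists because `Q₀` is one and the property is decidable; its size is
    -- at most that of `Q₀`.
    let Q , qk , min = minimumSubset isQuasiKernel? (Q₀ , qk₀)
    in Q , record { isQuasiKernel = qk ; minimum = min } , ≤-trans (min Q₀ qk₀) ∣Q₀∣≤k

  singleton-quasiKernel : ∀ {q} → (∀ v → Reaches v q) →
    ∃[ Q ] (IsQuasiKernel D Q × ∣ Q ∣ ≤ 2)
  singleton-quasiKernel {q} r =
    ⁅ q ⁆ ,
    quasiKernel⁺ ind (λ v → q , x∈⁅x⁆ q , r v) ,
    ≤-trans (≤-reflexive (∣⁅x⁆∣≡1 q)) (s≤s z≤n)
    where
    ind : IsIndependent D ⁅ q ⁆
    ind u v u∈ v∈ with x∈⁅y⁆⇒x≡y q u∈ | x∈⁅y⁆⇒x≡y q v∈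
    ... | refl | refl = loopless q

  pair-quasiKernel : ∀ {p q} → ¬ Arc p q → ¬ Arc q p →
    (∀ v → Reaches v p ⊎ Reaches v q) → ∃[ Q ] (IsQuasiKernel D Q × ∣ Q ∣ ≤ 2)
  pair-quasiKernel {p} {q} p↛q q↛p r =
    Q ,
    quasiKernel⁺ ind abs ,
    ≤-trans (∣p∪q∣≤∣p∣+∣q∣ ⁅ p ⁆ ⁅ q ⁆)
      (+-mono-≤ (≤-reflexive (∣⁅x⁆∣≡1 p)) (≤-reflexive (∣⁅x⁆∣≡1 q)))
    where
    Q : Subset n
    Q = ⁅ p ⁆ ∪ ⁅ q ⁆

    ∈Q⇒≡ : ∀ {u} → u ∈ Q → u ≡ p ⊎ u ≡ q
    ∈Q⇒≡ u∈Q with x∈p∪q⁻ ⁅ p ⁆ ⁅ q ⁆ u∈Q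
    ... | inj₁ u∈ = inj₁ (x∈⁅y⁆⇒x≡y p u∈)
    ... | inj₂ u∈ = inj₂ (x∈⁅y⁆⇒x≡y q u∈)

    ind : IsIndependent D Q
    ind u v u∈ v∈ with ∈Q⇒≡ u∈ | ∈Q⇒≡ v∈
    ... | inj₁ refl | inj₁ refl = loopless p
    ... | inj₁ refl | inj₂ refl = p↛q
    ... | inj₂ refl | inj₁ refl = q↛p
    ... | inj₂ refl | inj₂ refl = loopless q

    abs : Absorbing Q
    abs v with r v
    ... | inj₁ v⇝p = p , x∈p∪q⁺ (inj₁ (x∈⁅x⁆ p)) , v⇝p
    ... | inj₂ v⇝q = q , x∈p∪q⁺ (inj₂ (x∈⁅x⁆ q)) , v⇝q

  -- Kings

  -- The middle vertex is confined to `C` because `Unreached` knows the adjacencies of `x` only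
  -- towards `C`.
  ReachesWithin : Subset n → Fin n → Fin n → Set
  ReachesWithin C v q = v ≡ q ⊎ Arc v q ⊎ ∃[ w ] (w ∈ C × Arc v w × Arc w q)

  reachesWithin? : ∀ C v q → Dec (ReachesWithin C v q)
  reachesWithin? C v q =
    v ≟ q ⊎-dec arc? v q ⊎-dec any? (λ w → w ∈? C ×-dec arc? v w ×-dec arc? w q)

  reachesWithin⇒reaches : ∀ {C v q} → ReachesWithin C v q → Reaches v q
  reachesWithin⇒reaches (inj₁ v≡q) = inj₁ v≡q
  reachesWithin⇒reaches (inj₂ (inj₁ v→q)) = inj₂ (inj₁ v→q)
  reachesWithin⇒reaches (inj₂ (inj₂ (w , _ , v→w , w→q))) = inj₂ (inj₂ (w , v→w , w→q))

  Joined : Fin n → Fin n → Set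
  Joined u v = u ≢ v → Arc u v ⊎ Arc v u

  -- An arc from `x` to `q`, or to an in-neighbour of `q` in `C`, would give a walk from `x` to `q`.
  -- As `x` is joined to the vertices of `C`, the arcs between them must point to `x`. The king
  -- lemma and the sink-free case both rest on this reversal.
  module Unreached {C : Subset n} {x q : Fin n}
    (x⇝̸q : ¬ ReachesWithin C x q) (joined : ∀ {z} → z ∈ C → Joined x z) where

    target⇒arc : q ∈ C → Arc q x
    target⇒arc q∈C with joined q∈C (x⇝̸q ∘ inj₁)
    ... | inj₁ x→q = contradiction (inj₂ (inj₁ x→q)) x⇝̸q
    ... | inj₂ q→x = q→x

    inNeighbour⇒arc : ∀ {z} → z ∈ C → Arc z q → Arc z x
    inNeighbour⇒arc z∈C z→q
      with joined z∈C (λ { refl → x⇝̸q (inj₂ (inj₁ z→q)) })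
    ... | inj₁ x→z = contradiction (inj₂ (inj₂ (_ , z∈C , x→z , z→q))) x⇝̸q
    ... | inj₂ z→x = z→x

    -- The last vertex `q` of a nontrivial walk can be replaced by `x`, since the vertex before it
    -- has an arc to `x`; the trivial walk at `q` becomes the arc from `q` to `x`.
    retarget : ∀ {v} → v ∈ C → q ∈ C →
      ReachesWithin C v q → ReachesWithin C v x
    retarget v∈C q∈C (inj₁ refl) = inj₂ (inj₁ (target⇒arc q∈C))
    retarget v∈C q∈C (inj₂ (inj₁ v→q)) =
      inj₂ (inj₁ (inNeighbour⇒arc v∈C v→q))
    retarget v∈C q∈C (inj₂ (inj₂ (w , w∈C , v→w , w→q))) =
      inj₂ (inj₂ (w , w∈C , v→w , inNeighbour⇒arc w∈C w→q))

  module _ {C : Subset n} (joined : ∀ {u v} → u ∈ C → v ∈ C → Joined u v) where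

    -- A vertex x that does not reach the king k of the other vertices is itself
    -- a king, since k and its in-neighbours have arcs to x.
    king : ∀ x xs → (∀ {v} → v ∈ₗ x ∷ xs → v ∈ C) →
      ∃[ k ] (k ∈ₗ x ∷ xs × (∀ {v} → v ∈ₗ x ∷ xs → ReachesWithin C v k))
    king x [] _ = x , here refl , λ { (here refl) → inj₁ refl }
    king x (y ∷ ys) ⊆C with king y ys (⊆C ∘ there)
    ... | k , k∈ , reach with reachesWithin? C x k
    ...   | yes x⇝k = k , there k∈ , λ { (here refl) → x⇝k ; (there v∈) → reach v∈ }
    ...   | no x⇝̸k = x , here refl , λ
      { (here refl) → inj₁ refl
      ; (there v∈) →
          retarget (⊆C (there v∈)) (⊆C (there k∈)) (reach v∈) }
      where open Unreached x⇝̸k (joined (⊆C (here refl)))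

    -- `king` applied to a list of the vertices with `P`, nonempty thanks to `w`. The middle
    -- vertices of the walks are only claimed to lie in `C`.
    kingOf : ∀ {P : Pred (Fin n) 0ℓ} → Decidable P → (∀ {v} → P v → v ∈ C) → ∃ P →
      ∃[ k ] (P k × (∀ {v} → P v → ReachesWithin C v k))
    kingOf {P} P? P⊆C (w , pw) =
      fromList (filter P? (allFin n)) (∈-filter⁺ P? (∈-allFin _))
        (proj₂ ∘ ∈-filter⁻ P? {xs = allFin n})
      where
      fromList : ∀ xs → (∀ {v} → P v → v ∈ₗ xs) → (∀ {v} → v ∈ₗ xs → P v) →
        ∃[ k ] (P k × (∀ {v} → P v → ReachesWithin C v k))
      fromList [] complete _ with complete pw
      ... | ()
      fromList (x ∷ xs) complete sound =
        let k , k∈ , reach = king x xs (P⊆C ∘ sound)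
        in k , sound k∈ , reach ∘ complete

-- Arcs in a biorientation of a complete split graph

module _ {n : ℕ} {G : Graph n} {D : Digraph n}
  (split : IsCompleteSplit G) (bi : IsBiorientation G D) where
  open Digraph D
  open IsCompleteSplit split renaming (cliquePart to K)
  open IsBiorientation bi

  -- One endpoint in the clique-part is enough, whichever part contains the other.
  joined : ∀ {u v} → v ∈ K → Joined D u v
  joined {u} {v} v∈K u≢v with u ∈? K
  ... | yes u∈K = edge⇒arc u v (clique u v u∈K v∈K u≢v)
  ... | no u∉K  = edge⇒arc u v (complete u v (x∉p⇒x∈∁p u∉K) v∈K)

  ∉K⇒¬arc : ∀ {u v} → u ∉ K → v ∉ K → ¬ Arc u v
  ∉K⇒¬arc {u} {v} u∉K v∉K u→v =
    independent u v (x∉p⇒x∈∁p u∉K) (x∉p⇒x∈∁p v∉K) (arc⇒edge u v u→v)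

  inNeighbour∈K : ∀ {u v} → v ∉ K → Arc u v → u ∈ K
  inNeighbour∈K {u} v∉K u→v = decidable-stable (u ∈? K) λ u∉K → ∉K⇒¬arc u∉K v∉K u→v

  outNeighbour∈K : ∀ {u v} → u ∉ K → Arc u v → v ∈ K
  outNeighbour∈K {v = v} u∉K u→v =
    decidable-stable (v ∈? K) λ v∉K → ∉K⇒¬arc u∉K v∉K u→v

  -- Digraphs with a sink

  sinks-quasiKernel : HasSink D → IsQuasiKernel D (sinks D)
  sinks-quasiKernel (s , s-sink) = quasiKernel⁺ D
    (λ u v u∈ _ → ∈-comprehension⁻ (isSink? D) u∈ v)
    absorbing
    where
    toSink : ∀ {v} → Joined D s v → v ≡ s ⊎ Arc v s
    toSink {v} j with s ≟ v
    ... | yes refl = inj₁ refl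
    ... | no s≢v with j s≢v
    ...   | inj₁ s→v = contradiction s→v (s-sink v)
    ...   | inj₂ v→s = inj₂ v→s

    nonSink-reaches : ∀ {v} → ¬ IsSink D v → Reaches D v s
    nonSink-reaches {v} ¬sink with v ∈? K | s ∈? K
    ... | yes v∈K | _ = map₂ inj₁ (toSink (joined v∈K))
    -- `joined` takes the clique vertex as its second endpoint, here `s`, so its result is turned
    -- around.
    ... | no _ | yes s∈K = map₂ inj₁ (toSink (swap ∘ joined s∈K ∘ (_∘ sym)))
    -- Here `v` and `s` both lie in the independent-part, but an out-neighbour of `v` lies in the
    -- clique and is therefore joined to `s`.
    ... | no v∉K | no _ with outNeighbour D ¬sink
    ...   | w , v→w with toSink (joined (outNeighbour∈K v∉K v→w))
    ...     | inj₁ refl = inj₂ (inj₁ v→w)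
    ...     | inj₂ w→s  = inj₂ (inj₂ (w , v→w , w→s))

    absorbing : Absorbing D (sinks D)
    absorbing v with isSink? D v
    ... | yes v-sink = v , ∈-comprehension⁺ (isSink? D) v-sink , inj₁ refl
    ... | no ¬sink =
      s , ∈-comprehension⁺ (isSink? D) s-sink , nonSink-reaches ¬sink

  -- Sink-free digraphs

  clique-quasiKernel : (∀ v → v ∈ K) → ∃[ Q ] (IsQuasiKernel D Q × ∣ Q ∣ ≤ 2)
  clique-quasiKernel all∈K with any? (_∈? K)
  ... | yes nonempty =
    let k , _ , reach = kingOf D (λ _ → joined) (_∈? K) (λ v∈K → v∈K) nonempty
    in singleton-quasiKernel D λ v → reachesWithin⇒reaches D (reach (all∈K v))
  -- There are no vertices at all, and the empty set is a quasi-kernel.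
  ... | no empty =
    ⊥ ,
    quasiKernel⁺ D (λ _ _ u∈⊥ → contradiction u∈⊥ ∉⊥)
      (λ v → contradiction (v , all∈K v) empty) ,
    ≤-trans (≤-reflexive (∣⊥∣≡0 n)) z≤n

  N⁻ : Fin n → Subset n
  N⁻ v = comprehension (λ u → arc? u v)

  module _ {v : Fin n} (v∉K : v ∉ K) (max : ∀ u → u ∉ K → ∣ N⁻ u ∣ ≤ ∣ N⁻ v ∣) where

    -- Otherwise all of N⁻(v), and moreover b, would have arcs to u.
    ¬arc⊎reaches : ∀ {b u} → ¬ Arc b v → u ∉ K → ¬ Arc b u ⊎ Reaches D u v
    ¬arc⊎reaches {b} {u} b↛v u∉K with arc? b u | reaches? D u v
    ... | no b↛u | _ = inj₁ b↛u
    ... | yes _ | yes u⇝v = inj₂ u⇝v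
    ... | yes b→u | no u⇝̸v = contradiction (max u u∉K) (<⇒≱ (p⊂q⇒∣p∣<∣q∣
      (N⁻v⊆N⁻u ,
       b ,
       ∈-comprehension⁺ (λ z → arc? z u) b→u ,
       b↛v ∘ ∈-comprehension⁻ (λ z → arc? z v))))
      where
      open Unreached D {C = K} (u⇝̸v ∘ reachesWithin⇒reaches D) joined

      N⁻v⊆N⁻u : N⁻ v ⊆ N⁻ u
      N⁻v⊆N⁻u z∈ =
        let z→v = ∈-comprehension⁻ (λ z → arc? z v) z∈
        in ∈-comprehension⁺ (λ z → arc? z u) (inNeighbour⇒arc (inNeighbour∈K v∉K z→v) z→v)

    -- A vertex outside the clique is not a sink, and its out-neighbour lies in the clique, hence
    -- has an arc to `v`.
    allToMax-quasiKernel : SinkFree D → (∀ {u} → u ∈ K → Arc u v) →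
      ∃[ Q ] (IsQuasiKernel D Q × ∣ Q ∣ ≤ 2)
    allToMax-quasiKernel sinkFree K→v = singleton-quasiKernel D reach
      where
      reach : ∀ u → Reaches D u v
      reach u with u ∈? K
      ... | yes u∈K = inj₂ (inj₁ (K→v u∈K))
      ... | no u∉K =
        let w , u→w = outNeighbour D (λ sink → sinkFree (u , sink))
        in inj₂ (inj₂ (w , u→w , K→v (outNeighbour∈K u∉K u→w)))

    notAllToMax-quasiKernel : ∃[ w ] (w ∈ K × ¬ Arc w v) →
      ∃[ Q ] (IsQuasiKernel D Q × ∣ Q ∣ ≤ 2)
    notAllToMax-quasiKernel nonempty
      with kingOf D (λ _ → joined) (λ w → w ∈? K ×-dec ¬? (arc? w v)) proj₁ nonempty
    ... | b , (b∈K , b↛v) , reach with any? (λ x → ¬? (reaches? D x b))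
    ...   | no none = singleton-quasiKernel D λ x →
      decidable-stable (reaches? D x b) λ x⇝̸b → none (x , x⇝̸b)
    ...   | yes (x , x⇝̸b) =
      pair-quasiKernel D (∉K⇒¬arc v∉K x∉K) (∉K⇒¬arc x∉K v∉K) reach-pair
      where
      open Unreached D {C = K} (x⇝̸b ∘ reachesWithin⇒reaches D) joined

      v→b : Arc v b
      v→b with joined b∈K (λ v≡b → v∉K (subst (_∈ K) (sym v≡b) b∈K))
      ... | inj₁ arc = arc
      ... | inj₂ b→v = contradiction b→v b↛v

      K-reaches-b : ∀ {y} → y ∈ K → Reaches D y b
      -- Clique vertices with an arc to `v` go on along `v→b`; for the others `b` is a king.
      K-reaches-b {y} y∈K with arc? y v
      ... | yes y→v = inj₂ (inj₂ (v , y→v , v→b))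
      ... | no y↛v  = reachesWithin⇒reaches D (reach (y∈K , y↛v))

      x∉K : x ∉ K
      x∉K = x⇝̸b ∘ K-reaches-b

      reach-pair : ∀ y → Reaches D y v ⊎ Reaches D y x
      reach-pair y with y ∈? K | arc? y v
      ... | _ | yes y→v = inj₁ (inj₂ (inj₁ y→v))
      -- The walk from `y` to the king `b` is redirected to `x`, which `b` and its clique
      -- in-neighbours dominate.
      ... | yes y∈K | no y↛v = inj₂ (reachesWithin⇒reaches D
        (retarget y∈K b∈K (reach (y∈K , y↛v))))
      ... | no y∉K | no _ with reaches? D y x
      ...   | yes y⇝x = inj₂ y⇝x
      ...   | no y⇝̸x with ¬arc⊎reaches b↛v y∉K
      ...     | inj₂ y⇝v = inj₁ y⇝v
      ...     | inj₁ b↛y = contradiction b→y b↛y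
        where
        -- `b` is an in-neighbour of `x`, which `y` does not reach, so the edge between `b` and `y`
        -- carries an arc to `y`.
        b→y : Arc b y
        b→y = Unreached.inNeighbour⇒arc D {C = K}
          (y⇝̸x ∘ reachesWithin⇒reaches D) joined b∈K (target⇒arc b∈K)

  small-quasiKernel : SinkFree D → ∃[ Q ] (IsQuasiKernel D Q × ∣ Q ∣ ≤ 2)
  small-quasiKernel sinkFree with any? (λ v → ¬? (v ∈? K))
  ... | no none =
    clique-quasiKernel λ v → decidable-stable (v ∈? K) λ v∉K → none (v , v∉K)
  ... | yes nonempty with maximiser (λ v → ¬? (v ∈? K)) (∣_∣ ∘ N⁻) nonempty
  ...   | v , v∉K , max with any? (λ w → w ∈? K ×-dec ¬? (arc? w v))
  ...     | yes some = notAllToMax-quasiKernel v∉K max some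
  ...     | no none = allToMax-quasiKernel v∉K max sinkFree λ {u} u∈K →
    decidable-stable (arc? u v) λ u↛v → none (u , u∈K , u↛v)

theorem1p2 : ∀ (n : ℕ) (G : Graph n) (D : Digraph n) →
    IsCompleteSplit G → IsBiorientation G D →
    (HasSink D →
    ∃! _≡_ (IsMinimumQuasiKernel D) ×
    (∀ Q → IsMinimumQuasiKernel D Q → ∀ v → (v ∈ Q ⇔ IsSink D v))) ×
    (SinkFree D →
    ∃[ Q ] (IsMinimumQuasiKernel D Q × ∣ Q ∣ ≤ 2))
theorem1p2 n G D split bi =
  sinks-uniqueMinimum D ∘ sinks-quasiKernel split bi ,
  small⇒minimum D ∘ small-quasiKernel split bi
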